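{- Let $\mathrm{a}_{n,k}^{\mathrm{ddes}}(123,132)$ denote the number of permutations of $\{1,\dots,n\}$ that avoid both $123$ and $132$ and have exactly $k$ double descents. Then for all integers $n\ge3$ and $k\ge0$, $$\mathrm{a}_{n,k}^{\mathrm{ddes}}(123,132)=\binom{n-2}{k}+2\binom{n-3}{k}.$$
   Context: $\mathcal{S}_n$ is the set of permutations $\pi=\pi_1\cdots\pi_n$ of $\{1,\dots,n\}$. For $\rho\in\mathcal{S}_m$, $\pi\in\mathcal{S}_n$ contains $\rho$ if there are indices $1\le i_1<\cdots<i_m\le n$ such that $\pi_{i_a}<\pi_{i_b}$ if and only if $\rho_a<\rho_b$; otherwise $\pi$ avoids $\rho$. The number of double descents is $\mathrm{ddes}(\pi)=|\{i:\pi_i>\pi_{i+1}>\pi_{i+2}\}|$, where $1\le i\le n-2$. Binomial coefficients $\binom{m}{j}$ with $j>m\ge 0$ are $0$. -}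

module Defs where

open import Data.Fin.Base using (Fin; suc; inject₁; _<_; _>_)
open import Data.Fin.Patterns using (1F; 2F)
open import Data.Fin.Permutation using (Permutation′; _⟨$⟩ʳ_; id; transpose)
open import Data.Fin.Properties using (_<?_)
open import Data.List.Base using (length; filter; allFin)
open import Data.Nat.Base using (ℕ; zero; suc)
open import Data.Product.Base using (Σ-syntax; _×_; proj₁)
open import Function.Base using (_∘_)
open import Function.Bundles using (_⇔_; Inverse)
open import Level using (Level; 0ℓ; _⊔_)
open import Relation.Binary.Bundles using (Setoid)
open import Relation.Binary.PropositionalEquality using (_≡_; setoid; _→-setoid_)
open import Relation.Nullary.Decidable using (Dec; _×-dec_)
open import Relation.Nullary.Negation using (¬_)
import Relation.Binary.Construct.On as On

private
  variable
    c ℓ : Level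
    m n : ℕ

-- Positions and values are numbered from 0, so the (i + 1)-th letter of the
-- one-line word of π is 1 + π ⟨$⟩ʳ i.

Contains : Permutation′ m → Permutation′ n → Set
Contains {m} {n} ρ π =
  Σ[ ι ∈ (Fin m → Fin n) ]   (∀ (a b : Fin m) → a < b → ι a < ι b)
                           × (∀ (a b : Fin m) → (π ⟨$⟩ʳ ι a < π ⟨$⟩ʳ ι b) ⇔ (ρ ⟨$⟩ʳ a < ρ ⟨$⟩ʳ b))

Avoids : Permutation′ m → Permutation′ n → Set
Avoids ρ π = ¬ Contains ρ π

⟨123⟩ ⟨132⟩ : Permutation′ 3
⟨123⟩ = id
⟨132⟩ = transpose 1F 2F

-- The three entries sit at positions i, i + 1 and i + 2.
DoubleDescent : Permutation′ (suc (suc n)) → Fin n → Set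
DoubleDescent π i = π ⟨$⟩ʳ inject₁ (inject₁ i) > π ⟨$⟩ʳ suc (inject₁ i)
                  × π ⟨$⟩ʳ suc (inject₁ i) > π ⟨$⟩ʳ suc (suc i)

doubleDescent? : (π : Permutation′ (suc (suc n))) (i : Fin n) → Dec (DoubleDescent π i)
doubleDescent? π i = (_ <? _) ×-dec (_ <? _)

ddes : Permutation′ n → ℕ
ddes {zero}        π = 0
ddes {suc zero}    π = 0
ddes {suc (suc n)} π = length (filter (doubleDescent? π) (allFin n))

-- Permutations carry inverse functions and proofs, and avoidance is itself a
-- proof; elements are identified when their one-line words agree, so that each
-- permutation is counted once.
Avoiders : ℕ → ℕ → Setoid 0ℓ 0ℓ
Avoiders n k = On.setoid {B = Σ[ π ∈ Permutation′ n ] Avoids ⟨123⟩ π × Avoids ⟨132⟩ π × ddes π ≡ k}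
                         (Fin n →-setoid Fin n) (_⟨$⟩ʳ_ ∘ proj₁)

HasCardinality : Setoid c ℓ → ℕ → Set (c ⊔ ℓ)
HasCardinality S N = Inverse (setoid (Fin N)) S

{-# OPTIONS --safe #-}

-- A permutation π avoids 123 and 132 exactly when every letter has at most one
-- larger letter to its right.  Writing cᵢ ∈ {0, 1} for the number of letters
-- larger than πᵢ to its right, this encodes π by c₁ … cₙ₋₁ (and cₙ = 0), and
-- πᵢ < πᵢ₊₁ exactly when cᵢ cᵢ₊₁ = 10.  By induction on the word, the number of
-- double descents is the number of i ≤ n − 2 with cᵢ = cᵢ₊₁, less one if
-- c₁ = c₂ = 1.  Hence the words with c₁ = 0 contribute C(n − 2, k), while those
-- with c₁ = 1 contribute C(n − 3, k) for each of the two values of c₂.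

module Submission where

open import Defs
open import Data.Bool.Base using (Bool; true; false; not)
open import Data.Bool.Properties using (not-¬; ¬-not)
import Data.Bool.Properties as Bool
open import Data.Empty using (⊥; ⊥-elim)
open import Data.Fin.Base using (Fin; zero; suc; inject₁; fromℕ; punchIn; _<_; _>_)
open import Data.Fin.Patterns using (0F; 1F; 2F)
open import Data.Fin.Permutation using
  (Permutation′; _⟨$⟩ʳ_; _⟨$⟩ˡ_; id; _≈_; insert; remove; punchIn-permute; inverseʳ; cast-id)
open import Data.Fin.Properties using
  ( _≟_; suc-injective; <-cmp; <-asym; <-irrefl; ≤fromℕ; ≤∧≢⇒<; fromℕ≢inject₁; punchIn-injective; punchInᵢ≢i
  ; punchIn-mono-≤; punchIn-cancel-≤; 2↔Bool; +↔⊎; *↔× )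
open import Data.List.Base using (length; filter; tabulate)
open import Data.List.Properties using (filter-accept; filter-reject)
open import Data.Nat.Base using (ℕ; zero; suc; _+_; _*_; _∸_; _≥_; z≤n; s≤s; z<s; s<s)
open import Data.Nat.Combinatorics using (_C_; nCk+nC[k+1]≡[n+1]C[k+1])
import Data.Nat.Properties as ℕ
import Data.Product.Base as Product
open import Data.Product.Base using (∃; ∃₂; _×_; _,_; proj₂)
open import Data.Product.Function.NonDependent.Propositional using (_×-↔_)
open import Data.Sum.Base using (_⊎_; inj₁; inj₂)
open import Data.Sum.Function.Propositional using (_⊎-↔_)
open import Data.Vec.Base using ([]; _∷_; lookup)
open import Function.Base using (_∘_)
open import Function.Bundles using (_↔_; _⇔_; mk⇔; mk↔ₛ′; Injection; Equivalence; Bijection)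
open import Function.Construct.Composition using (inverse; _↔-∘_)
open import Function.Definitions using (Surjective)
open import Function.Properties.Bijection using (Bijection⇒Inverse)
open import Function.Properties.Inverse using (↔⇒↣)
open import Relation.Binary.Bundles using (Setoid)
open import Relation.Binary.Definitions using (Tri; tri<; tri≈; tri>)
open import Relation.Binary.PropositionalEquality
  using (_≡_; _≢_; refl; sym; trans; cong; subst; subst₂; setoid)
open import Relation.Nullary.Decidable using (yes; no)
open import Relation.Nullary.Negation using (¬_; contradiction)
open import Relation.Unary using (Decidable; Pred)

private
  variable
    m n k : ℕ

-- Order and injectivity facts about `punchIn` and prepended letters.

⟨$⟩ʳ-injective : (π : Permutation′ n) {i j : Fin n} → π ⟨$⟩ʳ i ≡ π ⟨$⟩ʳ j → i ≡ j
⟨$⟩ʳ-injective π = Injection.injective (↔⇒↣ π)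

punchIn-mono-< : ∀ (v : Fin (suc n)) {i j : Fin n} → i < j → punchIn v i < punchIn v j
punchIn-mono-< v {i} {j} i<j = ℕ.≰⇒> (λ le → ℕ.<⇒≱ i<j (punchIn-cancel-≤ v j i le))

punchIn-cancel-< : ∀ (v : Fin (suc n)) {i j : Fin n} → punchIn v i < punchIn v j → i < j
punchIn-cancel-< v {i} {j} lt = ℕ.≰⇒> (λ j≤i → ℕ.<⇒≱ lt (punchIn-mono-≤ v j i j≤i))

≢fromℕ⇒< : {i : Fin (suc n)} → i ≢ fromℕ n → i < fromℕ n
≢fromℕ⇒< = ≤∧≢⇒< (≤fromℕ _)

inject₁-fromℕ< : ∀ n → inject₁ (fromℕ n) < fromℕ (suc n)
inject₁-fromℕ< n = ≢fromℕ⇒< (fromℕ≢inject₁ ∘ sym)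

-- The letter cᵢ is true or false according as it is 1 or 0; a permutation with
-- first letter c₁ = b starts with the value top b.
top : Bool → Fin (suc (suc n))
top false = fromℕ _
top true  = inject₁ (fromℕ _)

top-injective : ∀ b c → top {n} b ≡ top c → b ≡ c
top-injective false false eq = refl
top-injective false true  eq = contradiction eq fromℕ≢inject₁
top-injective true  false eq = contradiction (sym eq) fromℕ≢inject₁
top-injective true  true  eq = refl

punchIn-fromℕ< : (x : Fin n) → punchIn (fromℕ n) x < fromℕ n
punchIn-fromℕ< x = ≢fromℕ⇒< (punchInᵢ≢i _ x)

-- Prepending the second largest value leaves one value above it, and the maximum of the tail moves
-- there.
punchIn-top-fromℕ : ∀ n → punchIn (top true) (fromℕ n) ≡ top false
punchIn-top-fromℕ zero    = refl
punchIn-top-fromℕ (suc n) = cong suc (punchIn-top-fromℕ n)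

-- Only the maximum of the tail can rise above a prepended `top b`; this is what keeps c₁ ≤ 1.
punchIn-top< : ∀ b {x : Fin (suc n)} → x < fromℕ n → punchIn (top b) x < top {n} b
punchIn-top<             false {x}     lt       = punchIn-fromℕ< x
punchIn-top< {n = suc n} true  {zero}  lt       = z<s
punchIn-top< {n = suc n} true  {suc x} (s<s lt) = s<s (punchIn-top< true lt)

top<punchIn⇒≡fromℕ : ∀ b {x : Fin (suc n)} → top {n} b < punchIn (top b) x → x ≡ fromℕ n
top<punchIn⇒≡fromℕ b {x} lt with x ≟ fromℕ _
... | yes eq = eq
... | no x≢  = contradiction lt (ℕ.<⇒≯ (punchIn-top< b (≢fromℕ⇒< x≢)))

≢top⇒< : {x : Fin (suc (suc n))} → (∀ b → x ≢ top b) → ∀ b → x < top {n} b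
≢top⇒<                   x≢ false = ≢fromℕ⇒< (x≢ false)
-- `Fin 2` consists of the two top values only, so the hypothesis fails here.
≢top⇒< {n = zero}  {0F}    x≢ true  = contradiction refl (x≢ true)
≢top⇒< {n = zero}  {1F}    x≢ true  = contradiction refl (x≢ false)
≢top⇒< {n = suc n} {zero}  x≢ true  = z<s
≢top⇒< {n = suc n} {suc x} x≢ true  =
  s<s (≢top⇒< (λ { false eq → x≢ false (cong suc eq) ; true eq → x≢ true (cong suc eq) }) true)

insert-cancel : {v w : Fin (suc n)} {π σ : Permutation′ n} →
                insert 0F v π ≈ insert 0F w σ → v ≡ w × π ≈ σ
insert-cancel {v = v} eq with refl ← eq 0F = refl , λ i → punchIn-injective v _ _ (eq (suc i))

insert-≈ : {v : Fin (suc n)} {σ : Permutation′ n} {π : Permutation′ (suc n)} →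
           v ≡ π ⟨$⟩ʳ 0F → σ ≈ remove 0F π → insert 0F v σ ≈ π
insert-≈         refl σ≈ 0F      = refl
insert-≈ {π = π} refl σ≈ (suc i) =
  trans (cong (punchIn (π ⟨$⟩ʳ 0F)) (σ≈ i)) (sym (punchIn-permute π 0F i))

-- Avoidance as a bound on the larger letters to the right.

AtMostOneLarger : Permutation′ n → Set
AtMostOneLarger π = ∀ {i a b} → i < a → i < b →
  π ⟨$⟩ʳ i < π ⟨$⟩ʳ a → π ⟨$⟩ʳ i < π ⟨$⟩ʳ b → a ≡ b

-- The converse of order preservation is automatic, because ρ is injective and
-- the order on Fin is total.
mkContains : (ρ : Permutation′ m) (π : Permutation′ n) (ι : Fin m → Fin n) →
             (∀ a b → a < b → ι a < ι b) →
             (∀ a b → ρ ⟨$⟩ʳ a < ρ ⟨$⟩ʳ b → π ⟨$⟩ʳ ι a < π ⟨$⟩ʳ ι b) →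
             Contains ρ π
mkContains ρ π ι ι-mono mono = ι , ι-mono , λ a b → mk⇔ (cancel a b) (mono a b)
  where
  cancel : ∀ a b → π ⟨$⟩ʳ ι a < π ⟨$⟩ʳ ι b → ρ ⟨$⟩ʳ a < ρ ⟨$⟩ʳ b
  cancel a b lt with <-cmp (ρ ⟨$⟩ʳ a) (ρ ⟨$⟩ʳ b)
  ... | tri< lt′ _ _ = lt′
  ... | tri≈ _ eq _  = contradiction lt (<-irrefl (cong (λ c → π ⟨$⟩ʳ ι c) (⟨$⟩ʳ-injective ρ eq)))
  ... | tri> _ _ gt  = contradiction lt (<-asym (mono b a gt))

elim-<₃ : (R : Fin 3 → Fin 3 → Set) → R 0F 1F → R 0F 2F → R 1F 2F → ∀ c d → c < d → R c d
elim-<₃ R r₀₁ r₀₂ r₁₂ 0F 1F _ = r₀₁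
elim-<₃ R r₀₁ r₀₂ r₁₂ 0F 2F _ = r₀₂
elim-<₃ R r₀₁ r₀₂ r₁₂ 1F 2F _ = r₁₂
elim-<₃ R r₀₁ r₀₂ r₁₂ 1F 1F (s<s ())
elim-<₃ R r₀₁ r₀₂ r₁₂ 2F 1F (s<s ())
elim-<₃ R r₀₁ r₀₂ r₁₂ 2F 2F (s<s (s<s ()))

module _ (π : Permutation′ n) (av123 : Avoids ⟨123⟩ π) (av132 : Avoids ⟨132⟩ π) where

  private
    -- The letters at `a` and `b` complete a 123 or a 132 with the letter at `i`, according to which
    -- of them is larger.
    ordered : ∀ {i a b} → i < a → a < b → π ⟨$⟩ʳ i < π ⟨$⟩ʳ a → π ⟨$⟩ʳ i < π ⟨$⟩ʳ b → ⊥
    ordered {i} {a} {b} i<a a<b πi<πa πi<πb = compare (<-cmp (π ⟨$⟩ʳ a) (π ⟨$⟩ʳ b))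
      where
      ι : Fin 3 → Fin n
      ι = lookup (i ∷ a ∷ b ∷ [])

      ι-mono : ∀ c d → c < d → ι c < ι d
      ι-mono = elim-<₃ (λ c d → ι c < ι d) i<a (ℕ.<-trans i<a a<b) a<b

      compare : Tri (π ⟨$⟩ʳ a < π ⟨$⟩ʳ b) (π ⟨$⟩ʳ a ≡ π ⟨$⟩ʳ b) (π ⟨$⟩ʳ b < π ⟨$⟩ʳ a) → ⊥
      compare (tri≈ _ eq _)    = <-irrefl (⟨$⟩ʳ-injective π eq) a<b
      compare (tri< πa<πb _ _) = av123 (mkContains ⟨123⟩ π ι ι-mono
        (elim-<₃ (λ c d → π ⟨$⟩ʳ ι c < π ⟨$⟩ʳ ι d) πi<πa πi<πb πa<πb))
      compare (tri> _ _ πb<πa) = av132 (mkContains ⟨132⟩ π ι ι-mono mono)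
        where
        -- The positions of `⟨132⟩` in increasing order of their letters are 0, 2, 1.
        mono : ∀ c d → ⟨132⟩ ⟨$⟩ʳ c < ⟨132⟩ ⟨$⟩ʳ d → π ⟨$⟩ʳ ι c < π ⟨$⟩ʳ ι d
        mono 0F 1F _ = πi<πa
        mono 0F 2F _ = πi<πb
        mono 2F 1F _ = πb<πa
        mono 1F 1F (s<s (s<s ()))
        mono 1F 2F (s<s ())
        mono 2F 2F (s<s ())

  avoids⇒atMostOneLarger : AtMostOneLarger π
  avoids⇒atMostOneLarger {a = a} {b} i<a i<b πi<πa πi<πb with <-cmp a b
  ... | tri< a<b _ _ = ⊥-elim (ordered i<a a<b πi<πa πi<πb)
  ... | tri≈ _ a≡b _ = a≡b
  ... | tri> _ _ b<a = ⊥-elim (ordered i<b b<a πi<πb πi<πa)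

-- Both patterns begin with their smallest letter, so an occurrence of either has two larger letters
-- to the right of its first one.
atMostOneLarger⇒avoids : (ρ : Permutation′ 3) → ρ ⟨$⟩ʳ 0F ≡ 0F →
                         (π : Permutation′ n) → AtMostOneLarger π → Avoids ρ π
atMostOneLarger⇒avoids ρ ρ0≡0 π P (ι , ι-mono , iff) =
  <-irrefl (P (ι-mono 0F 1F z<s) (ι-mono 0F 2F z<s) (larger 1F λ ()) (larger 2F λ ())) (ι-mono 1F 2F (s<s z<s))
  where
  larger : ∀ a → a ≢ 0F → π ⟨$⟩ʳ ι 0F < π ⟨$⟩ʳ ι a
  larger a a≢0 = Equivalence.from (iff 0F a) (subst (_< ρ ⟨$⟩ʳ a) (sym ρ0≡0)
    (≤∧≢⇒< z≤n λ 0≡ρa → a≢0 (⟨$⟩ʳ-injective ρ (trans (sym 0≡ρa) (sym ρ0≡0)))))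

-- Any letter above the new first one comes from the maximum of `π`, hence from one position; all
-- other comparisons are those of `π`.
insert-atMostOneLarger : ∀ b {π : Permutation′ (suc n)} → AtMostOneLarger π →
                         AtMostOneLarger (insert 0F (top b) π)
insert-atMostOneLarger b {π} P {zero}  {suc x} {suc y} _ _ lt₁ lt₂ =
  cong suc (⟨$⟩ʳ-injective π (trans (top<punchIn⇒≡fromℕ b lt₁) (sym (top<punchIn⇒≡fromℕ b lt₂))))
insert-atMostOneLarger b {π} P {suc i} {suc x} {suc y} (s<s i<x) (s<s i<y) lt₁ lt₂ =
  cong suc (P i<x i<y (punchIn-cancel-< (top b) lt₁) (punchIn-cancel-< (top b) lt₂))

remove-atMostOneLarger : (π : Permutation′ (suc n)) → AtMostOneLarger π → AtMostOneLarger (remove 0F π)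
remove-atMostOneLarger π P i<a i<b lt₁ lt₂ =
  suc-injective (P (s<s i<a) (s<s i<b) (lift lt₁) (lift lt₂))
  where
  lift : ∀ {i j} → remove 0F π ⟨$⟩ʳ i < remove 0F π ⟨$⟩ʳ j → π ⟨$⟩ʳ suc i < π ⟨$⟩ʳ suc j
  lift {i} {j} lt = subst₂ _<_ (sym (punchIn-permute π 0F i)) (sym (punchIn-permute π 0F j))
                      (punchIn-mono-< (π ⟨$⟩ʳ 0F) lt)

-- Otherwise both top values would lie to the right of the first letter and exceed it, so they would
-- share a position.
head-top : (π : Permutation′ (suc (suc n))) → AtMostOneLarger π → ∃ λ b → top b ≡ π ⟨$⟩ʳ 0F
head-top {n} π P with top false ≟ π ⟨$⟩ʳ 0F | top true ≟ π ⟨$⟩ʳ 0F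
... | yes eq | _      = false , eq
... | no _   | yes eq = true , eq
... | no ≢f  | no ≢t  = contradiction same λ ()
  where
  head≢ : ∀ b → π ⟨$⟩ʳ 0F ≢ top b
  head≢ false = ≢f ∘ sym
  head≢ true  = ≢t ∘ sym

  at : Bool → Fin _
  at b = π ⟨$⟩ˡ top b

  0<at : ∀ b → zero {suc n} < at b
  0<at b = ≤∧≢⇒< z≤n λ 0≡ → head≢ b (trans (cong (π ⟨$⟩ʳ_) 0≡) (inverseʳ π))

  larger : ∀ b → π ⟨$⟩ʳ 0F < π ⟨$⟩ʳ at b
  larger b = subst (π ⟨$⟩ʳ 0F <_) (sym (inverseʳ π)) (≢top⇒< head≢ b)

  same : false ≡ true
  same = top-injective false true (trans (sym (inverseʳ π))
    (trans (cong (π ⟨$⟩ʳ_) (P (0<at false) (0<at true) (larger false) (larger true))) (inverseʳ π)))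

-- Double descents when a letter is prepended.

length-filter-tabulate : ∀ {a b p q} {A : Set a} {B : Set b} {P : Pred A p} {Q : Pred B q}
  (P? : Decidable P) (Q? : Decidable Q) (f : Fin n → A) (g : Fin n → B) →
  (∀ i → P (f i) ⇔ Q (g i)) →
  length (filter P? (tabulate f)) ≡ length (filter Q? (tabulate g))
length-filter-tabulate {n = zero}  P? Q? f g P⇔Q = refl
length-filter-tabulate {n = suc n} P? Q? f g P⇔Q
  with ih ← length-filter-tabulate P? Q? (f ∘ suc) (g ∘ suc) (P⇔Q ∘ suc) | P? (f 0F) | Q? (g 0F)
... | yes _ | yes _ = cong suc ih
... | no  _ | no  _ = ih
... | yes p | no ¬q = contradiction (Equivalence.to (P⇔Q 0F) p) ¬q
... | no ¬p | yes q = contradiction (Equivalence.from (P⇔Q 0F) q) ¬p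

ddes-cong : (π σ : Permutation′ n) → π ≈ σ → ddes π ≡ ddes σ
ddes-cong {zero}        π σ eq = refl
ddes-cong {suc zero}    π σ eq = refl
ddes-cong {suc (suc n)} π σ eq = length-filter-tabulate (doubleDescent? π) (doubleDescent? σ) (λ i → i) (λ i → i)
  λ i → mk⇔ (Product.map (subst₂ _>_ (eq _) (eq _)) (subst₂ _>_ (eq _) (eq _)))
            (Product.map (subst₂ _>_ (sym (eq _)) (sym (eq _))) (subst₂ _>_ (sym (eq _)) (sym (eq _))))

module _ (v : Fin (suc (suc (suc n)))) (σ : Permutation′ (suc (suc n))) where

  private
    π = insert 0F v σ

    -- Past index 0 all three letters lie in `σ`, whose order `punchIn v` preserves and reflects.
    tail : length (filter (doubleDescent? π) (tabulate suc)) ≡ ddes σ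
    tail = length-filter-tabulate (doubleDescent? π) (doubleDescent? σ) suc (λ i → i)
      λ i → mk⇔ (Product.map (punchIn-cancel-< v) (punchIn-cancel-< v))
                (Product.map (punchIn-mono-< v) (punchIn-mono-< v))

  ddes-insert-accept : DoubleDescent π 0F → ddes π ≡ suc (ddes σ)
  ddes-insert-accept dd = trans (cong length (filter-accept (doubleDescent? π) dd)) (cong suc tail)

  ddes-insert-reject : ¬ DoubleDescent π 0F → ddes π ≡ ddes σ
  ddes-insert-reject ¬dd = trans (cong length (filter-reject (doubleDescent? π) ¬dd)) tail

-- A first letter and an element of Steps m k describe a word c₁ … cₘ₊₁ with
-- exactly k pairs of equal neighbours.
data Steps : ℕ → ℕ → Set where
  []   : Steps 0 0
  same : Steps m k → Steps (suc m) (suc k)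
  flip : Steps m k → Steps (suc m) k

-- The Boolean is the letter just read, from which `same` and `flip` determine the next one. At `[]`
-- only the last letter remains, with cₙ = 0, whence `id`.
perm : Bool → Steps m k → Permutation′ (suc (suc m))
permTail : Bool → Steps m k → Permutation′ (suc m)

perm b s = insert 0F (top b) (permTail b s)

permTail b []       = id
permTail b (same s) = perm b s
permTail b (flip s) = perm (not b) s

-- Double descents of the encoded permutations.

descent-false : (s : Steps m k) → perm false s ⟨$⟩ʳ 0F > perm false s ⟨$⟩ʳ 1F
descent-false s = punchIn-fromℕ< _

-- The tail starts with its second largest letter, hence not with the only letter that could exceed
-- `top b`.
descent-true : ∀ b (s : Steps m k) →
               insert 0F (top b) (perm true s) ⟨$⟩ʳ 0F > insert 0F (top b) (perm true s) ⟨$⟩ʳ 1F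
descent-true {m} b s = punchIn-top< b (inject₁-fromℕ< m)

-- The tail starts with its maximum, the one letter that rises above a prepended `top true`.
ascent : (s : Steps m k) → insert 0F (top true) (perm false s) ⟨$⟩ʳ 0F < insert 0F (top true) (perm false s) ⟨$⟩ʳ 1F
ascent {m} s = subst (inject₁ (fromℕ (suc m)) <_) (sym (punchIn-top-fromℕ (suc m))) (inject₁-fromℕ< (suc m))

module _ (v : Fin (suc (suc (suc n)))) (π : Permutation′ (suc (suc n))) where

  ddes-insert-ascent : π ⟨$⟩ʳ 0F < π ⟨$⟩ʳ 1F → ddes (insert 0F v π) ≡ ddes π
  ddes-insert-ascent lt = ddes-insert-reject v π λ (_ , gt) → <-asym (punchIn-mono-< v lt) gt

  ddes-insert-descent : insert 0F v π ⟨$⟩ʳ 0F > insert 0F v π ⟨$⟩ʳ 1F → π ⟨$⟩ʳ 0F > π ⟨$⟩ʳ 1F →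
                        ddes (insert 0F v π) ≡ suc (ddes π)
  ddes-insert-descent gt₁ gt₂ = ddes-insert-accept v π (gt₁ , punchIn-mono-< v gt₂)

-- Simultaneous induction over words beginning with 0, with 10 and with b1. If c₂ = 0, then π₂ > π₃,
-- so a double descent at the front means c₁ = c₂. If c₂ = 1, then π₁ > π₂, so it means c₂ = c₃;
-- hence the count for b1 does not depend on b.
ddes-perm-false : (s : Steps m k) → ddes (perm false s) ≡ k
ddes-insert-true-perm-false : (s : Steps m k) → ddes (insert 0F (top true) (perm false s)) ≡ k
ddes-insert-perm-true : ∀ b (s : Steps m k) → ddes (insert 0F (top b) (perm true s)) ≡ k

ddes-perm-false []       = refl
ddes-perm-false (same s) =
  trans (ddes-insert-descent (top false) (perm false s) (descent-false (same s)) (descent-false s))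
        (cong suc (ddes-perm-false s))
ddes-perm-false (flip s) = ddes-insert-perm-true false s

ddes-insert-true-perm-false s =
  trans (ddes-insert-reject (top true) (perm false s) λ (gt , _) → <-asym (ascent s) gt)
        (ddes-perm-false s)

-- `perm true []` is the ascending word of length 2: c₂ = 1 meets the final c₃ = 0.
ddes-insert-perm-true b []       = ddes-insert-ascent (top b) (perm true []) z<s
ddes-insert-perm-true b (same s) =
  trans (ddes-insert-descent (top b) (perm true (same s)) (descent-true b (same s)) (descent-true true s))
        (cong suc (ddes-insert-perm-true true s))
ddes-insert-perm-true b (flip s) =
  trans (ddes-insert-ascent (top b) (perm true (flip s)) (ascent s))
        (ddes-insert-true-perm-false s)

ddes-insert-true-perm : ∀ b (s : Steps m k) → ddes (insert 0F (top true) (perm b s)) ≡ k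
ddes-insert-true-perm false = ddes-insert-true-perm-false
ddes-insert-true-perm true  = ddes-insert-perm-true true

-- Range, injectivity and surjectivity of the encoding.

perm-atMostOneLarger : ∀ b (s : Steps m k) → AtMostOneLarger (perm b s)
permTail-atMostOneLarger : ∀ b (s : Steps m k) → AtMostOneLarger (permTail b s)

perm-atMostOneLarger b s = insert-atMostOneLarger b (permTail-atMostOneLarger b s)

permTail-atMostOneLarger b []       {a = 0F} {0F} _ _ _ _ = refl
permTail-atMostOneLarger b (same s) = perm-atMostOneLarger b s
permTail-atMostOneLarger b (flip s) = perm-atMostOneLarger (not b) s

permTail-injective : ∀ b (s t : Steps m k) → permTail b s ≈ permTail b t → s ≡ t
permTail-injective b []       []       eq = refl
permTail-injective b (same s) (same t) eq =
  cong same (permTail-injective b s t (proj₂ (insert-cancel eq)))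
permTail-injective b (flip s) (flip t) eq =
  cong flip (permTail-injective (not b) s t (proj₂ (insert-cancel eq)))
permTail-injective b (same s) (flip t) eq = contradiction (top-injective b (not b) (eq 0F)) (not-¬ refl)
permTail-injective b (flip s) (same t) eq = contradiction (top-injective b (not b) (sym (eq 0F))) (not-¬ refl)

perm-injective : ∀ b c (s t : Steps m k) → perm b s ≈ perm c t → (b , s) ≡ (c , t)
perm-injective b c s t eq with refl ← top-injective b c (eq 0F) =
  cong (b ,_) (permTail-injective b s t (proj₂ (insert-cancel eq)))

-- The first letter is a top value by `head-top`, and the standardised tail is decoded recursively;
-- comparing the two leading Booleans tells `same` from `flip`.
perm-surjective : (π : Permutation′ (suc (suc m))) → AtMostOneLarger π →
                  ∃ λ b → ∃₂ λ k (s : Steps m k) → perm b s ≈ π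
perm-surjective {zero} π P with b , eq ← head-top π P = b , 0 , [] , insert-≈ {π = π} eq single
  where
  single : id ≈ remove 0F π
  single 0F with remove 0F π ⟨$⟩ʳ 0F
  ... | 0F = refl
perm-surjective {suc m} π P
  with b , eq ← head-top π P
     | c , k , s , s≈ ← perm-surjective (remove 0F π) (remove-atMostOneLarger π P)
  with b Bool.≟ c
... | yes refl = b , suc k , same s , insert-≈ {π = π} eq s≈
... | no b≢c with refl ← ¬-not (b≢c ∘ sym) = b , k , flip s , insert-≈ {π = π} eq s≈

-- Counting words by binomial coefficients.

Steps-↔ : ∀ m k → Fin (m C k) ↔ Steps m k
Steps-↔ zero    zero    = mk↔ₛ′ (λ _ → []) (λ _ → 0F) (λ { [] → refl }) (λ { 0F → refl ; (suc ()) })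
Steps-↔ zero    (suc k) = mk↔ₛ′ (λ ()) (λ ()) (λ ()) (λ ())
-- With no `same` available every step is `flip`, and both binomials compute to 1.
Steps-↔ (suc m) zero    =
  mk↔ₛ′ flip (λ { (flip s) → s }) (λ { (flip s) → refl }) (λ _ → refl) ↔-∘ Steps-↔ m zero
-- Pascal's rule, read as the choice of the first step.
Steps-↔ (suc m) (suc k) = split ↔-∘ ((Steps-↔ m k ⊎-↔ Steps-↔ m (suc k)) ↔-∘
                          (+↔⊎ ↔-∘ cast-id (sym (nCk+nC[k+1]≡[n+1]C[k+1] m k))))
  where
  split : (Steps m k ⊎ Steps m (suc k)) ↔ Steps (suc m) (suc k)
  split = mk↔ₛ′ (λ { (inj₁ s) → same s ; (inj₂ s) → flip s })
                (λ { (same s) → inj₁ s ; (flip s) → inj₂ s })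
                (λ { (same s) → refl ; (flip s) → refl })
                (λ { (inj₁ s) → refl ; (inj₂ s) → refl })

-- For c₁ = true the step from c₁ to c₂ is not recorded, since a pair
-- c₁ = c₂ = true does not add to the count.
Code : ℕ → ℕ → Set
Code m k = Steps (suc m) k ⊎ (Bool × Steps m k)

Code-↔ : ∀ m k → Fin ((suc m C k) + 2 * (m C k)) ↔ Code m k
Code-↔ m k = (Steps-↔ (suc m) k ⊎-↔ ((2↔Bool ×-↔ Steps-↔ m k) ↔-∘ *↔×)) ↔-∘ +↔⊎

codePerm : Code m k → Permutation′ (3 + m)
codePerm (inj₁ s)       = perm false s
codePerm (inj₂ (b , s)) = insert 0F (top true) (perm b s)

codePerm-atMostOneLarger : (x : Code m k) → AtMostOneLarger (codePerm x)
codePerm-atMostOneLarger (inj₁ s)       = perm-atMostOneLarger false s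
codePerm-atMostOneLarger (inj₂ (b , s)) = insert-atMostOneLarger true (perm-atMostOneLarger b s)

ddes-codePerm : (x : Code m k) → ddes (codePerm x) ≡ k
ddes-codePerm (inj₁ s)       = ddes-perm-false s
ddes-codePerm (inj₂ (b , s)) = ddes-insert-true-perm b s

codePerm-injective : (x y : Code m k) → codePerm x ≈ codePerm y → x ≡ y
codePerm-injective (inj₁ s) (inj₁ t) eq = cong inj₁ (permTail-injective false s t (proj₂ (insert-cancel eq)))
codePerm-injective (inj₁ _) (inj₂ _) eq = contradiction (top-injective false true (eq 0F)) λ ()
codePerm-injective (inj₂ _) (inj₁ _) eq = contradiction (top-injective true false (eq 0F)) λ ()
codePerm-injective (inj₂ (b , s)) (inj₂ (c , t)) eq =
  cong inj₂ (perm-injective b c s t (proj₂ (insert-cancel eq)))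

codePerm-surjective : (π : Permutation′ (3 + m)) → AtMostOneLarger π →
                      ∃₂ λ k (x : Code m k) → codePerm x ≈ π
codePerm-surjective π P with perm-surjective π P
... | false , _ , s      , eq = _ , inj₁ s           , eq
-- The code omits this `same`, so its index is one less than that of the steps.
... | true  , _ , same s , eq = _ , inj₂ (true , s)  , eq
... | true  , _ , flip s , eq = _ , inj₂ (false , s) , eq

-- The bijection between codes and avoiders.

Code⤖Avoiders : ∀ m k → Bijection (setoid (Code m k)) (Avoiders (3 + m) k)
Code⤖Avoiders m k = record
  { to        = to
  ; cong      = λ { refl _ → refl }
  ; bijective = codePerm-injective _ _ , surjective
  }
  where
  to : Code m k → Setoid.Carrier (Avoiders (3 + m) k)
  to x = codePerm x , avoids ⟨123⟩ refl , avoids ⟨132⟩ refl , ddes-codePerm x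
    where
    avoids : (ρ : Permutation′ 3) → ρ ⟨$⟩ʳ 0F ≡ 0F → Avoids ρ (codePerm x)
    avoids ρ ρ0≡0 = atMostOneLarger⇒avoids ρ ρ0≡0 (codePerm x) (codePerm-atMostOneLarger x)

  surjective : Surjective _≡_ (Setoid._≈_ (Avoiders (3 + m) k)) to
  surjective (π , av123 , av132 , refl)
    with j , x , eq ← codePerm-surjective π (avoids⇒atMostOneLarger π av123 av132)
    -- `j` is the number of double descents of `codePerm x`, hence of `π`, so it is the prescribed
    -- index.
    with refl ← trans (sym (ddes-codePerm x)) (ddes-cong (codePerm x) π eq) = x , λ { refl → eq }

proposition16 : (n k : ℕ) → n ≥ 3 →
    HasCardinality (Avoiders n k) (((n ∸ 2) C k) + 2 * ((n ∸ 3) C k))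
proposition16 1 k (s≤s ())
proposition16 2 k (s≤s (s≤s ()))
proposition16 (suc (suc (suc m))) k _ = inverse (Code-↔ m k) (Bijection⇒Inverse (Code⤖Avoiders m k))
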